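{- Let $S : \mathsf{Type}$, $\mathbf{P} : Ind \to S \to \mathsf{Type}$, $Q : S \to \mathsf{Type}$, and fix $\mathbf{X} : Ind \to \mathsf{Type}$. Let $G : \mathsf{Type}\to\mathsf{Type}$ be the functor $G\,Y = \sum_{s:S}\big(((ind:Ind) \to \mathbf{P}\,ind\,s \to \mathbf{X}\,ind) \times (Q\,s \to Y)\big)$ (acting on a function $g$ by post-composing the $Y$-component with $g$). Then the type $$T_\mu = \sum_{w : \mathsf{W}\,S\,Q}\big((ind : Ind) \to \mathsf{Pos}\,\mathsf{WAlg}\,ind\,w \to \mathbf{X}\,ind\big)$$ carries a $G$-algebra structure $\mathsf{into} : G\,T_\mu \to T_\mu$ such that $(T_\mu,\mathsf{into})$ is an initial $G$-algebra: for every $G$-algebra $(Y,\alpha)$ the type of algebra morphisms $(T_\mu,\mathsf{into}) \to (Y,\alpha)$ is contractible. Concretely, $\mathsf{into}$ sends $(s, g, k)$ with $g : (ind:Ind)\to\mathbf{P}\,ind\,s\to\mathbf{X}\,ind$ and $k : Q\,s \to T_\mu$ to $(\mathsf{sup}\,s\,(\lambda q.\,\pi_1(k\,q)),\ \ell)$ where $\ell\,ind\,(\mathsf{here}\,p) = g\,ind\,p$ and $\ell\,ind\,(\mathsf{below}\,q\,p) = \pi_2(k\,q)\,ind\,p$.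
   Context: Work in intensional type theory (Cubical Agda) with function extensionality and without assuming UIP; $\mathsf{Type}$ is regarded as a wild category (no h-set assumptions). $\mathsf{W}\,S\,Q$ is the inductive type with single constructor $\mathsf{sup} : (s:S) \to (Q\,s \to \mathsf{W}\,S\,Q) \to \mathsf{W}\,S\,Q$. $\mathsf{WAlg}$ is the fixed point of $\llbracket S\triangleleft Q\rrbracket X = \sum_{s:S}(Q\,s\to X)$ with carrier $\mathsf{W}\,S\,Q$ and equivalence $(s,f)\mapsto \mathsf{sup}\,s\,f$, whose inverse $\xi$ has $\xi_0(\mathsf{sup}\,s\,f) = s$, $\xi_1(\mathsf{sup}\,s\,f) = f$. For a fixed point $(C,\chi)$ with inverse components $\xi_0 : C\to S$, $\xi_1\,c : Q(\xi_0\,c)\to C$, and $ind : Ind$, $\mathsf{Pos}\,(C,\chi)\,ind : C \to \mathsf{Type}$ is the inductive family with constructors $\mathsf{here} : \mathbf{P}\,ind\,(\xi_0\,c) \to \mathsf{Pos}\,(C,\chi)\,ind\,c$ and $\mathsf{below} : (q : Q(\xi_0\,c)) \to \mathsf{Pos}\,(C,\chi)\,ind\,(\xi_1\,c\,q) \to \mathsf{Pos}\,(C,\chi)\,ind\,c$. A $G$-algebra is a pair $(Y, \alpha : G\,Y \to Y)$; an algebra morphism $(Y,\alpha)\to(Z,\beta)$ is a pair of a function $f : Y \to Z$ and a path $f\circ\alpha = \beta\circ G\,f$. An algebra is initial if all types of morphisms out of it are contractible. -}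

{-# OPTIONS --without-K #-}
module Defs where

open import Data.Container.Core using (_▷_; ⟦_⟧)
open import Data.Product.Base using (Σ-syntax; _×_; _,_; proj₁; proj₂)
open import Data.W using (W; sup; head; tail)
open import Function.Base using (id; _∘_)
open import Function.Properties.Inverse.HalfAdjointEquivalence using (_≃_)
open import Level using (Level; suc)
open import Relation.Binary.PropositionalEquality.Core using (_≡_; refl)

private
  variable
    ℓ : Level

isContr : Set ℓ → Set ℓ
isContr A = Σ[ x ∈ A ] ((y : A) → x ≡ y)

-- Endofunctors of the wild category of types: no coherence is required of
-- the functor laws.
record WildFunctor (ℓ : Level) : Set (suc ℓ) where
  field
    F₀   : Set ℓ → Set ℓ
    F₁   : {A B : Set ℓ} → (A → B) → F₀ A → F₀ B
    F-id : {A : Set ℓ} → F₁ (id {A = A}) ≡ id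
    F-∘  : {A B C : Set ℓ} (g : B → C) (f : A → B) → F₁ (g ∘ f) ≡ F₁ g ∘ F₁ f

module _ (F : WildFunctor ℓ) where
  open WildFunctor F

  Algebra : Set (suc ℓ)
  Algebra = Σ[ Y ∈ Set ℓ ] (F₀ Y → Y)

  AlgebraMorphism : Algebra → Algebra → Set ℓ
  AlgebraMorphism (Y , α) (Z , β) = Σ[ f ∈ (Y → Z) ] (f ∘ α ≡ β ∘ F₁ f)

  IsInitial : Algebra → Set (suc ℓ)
  IsInitial A = (B : Algebra) → isContr (AlgebraMorphism A B)

module _ (S : Set ℓ) (Q : S → Set ℓ) where

  record FixedPoint : Set (suc ℓ) where
    field
      Carrier : Set ℓ
      χ       : ⟦ S ▷ Q ⟧ Carrier ≃ Carrier

    ξ₀ : Carrier → S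
    ξ₀ c = proj₁ (_≃_.from χ c)

    ξ₁ : (c : Carrier) → Q (ξ₀ c) → Carrier
    ξ₁ c = proj₂ (_≃_.from χ c)

  WAlg : FixedPoint
  WAlg = record
    { Carrier = W (S ▷ Q)
    ; χ       = record
      { to               = sup
      ; from             = λ w → head w , tail w
      ; left-inverse-of  = λ _ → refl
      ; right-inverse-of = λ { (sup _) → refl }
      ; left-right       = λ _ → refl
      }
    }

module _ {Ind S : Set ℓ} (P : Ind → S → Set ℓ) (Q : S → Set ℓ) where

  data Pos (C : FixedPoint S Q) (ind : Ind) : FixedPoint.Carrier C → Set ℓ where
    here  : ∀ {c} → P ind (FixedPoint.ξ₀ C c) → Pos C ind c
    below : ∀ {c} (q : Q (FixedPoint.ξ₀ C c)) →
            Pos C ind (FixedPoint.ξ₁ C c q) → Pos C ind c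

  module _ (X : Ind → Set ℓ) where

    G : WildFunctor ℓ
    G = record
      { F₀   = λ Y → Σ[ s ∈ S ] (((ind : Ind) → P ind s → X ind) × (Q s → Y))
      ; F₁   = λ { g (s , h , k) → s , h , g ∘ k }
      ; F-id = refl
      ; F-∘  = λ _ _ → refl
      }

    Tμ : Set ℓ
    Tμ = Σ[ w ∈ W (S ▷ Q) ] ((ind : Ind) → Pos (WAlg S Q) ind w → X ind)

    into : WildFunctor.F₀ G Tμ → Tμ
    into (s , g , k) = sup (s , λ q → proj₁ (k q)) , label
      where
      label : (ind : Ind) →
              Pos (WAlg S Q) ind (sup (s , λ q → proj₁ (k q))) → X ind
      label ind (here p)    = g ind p
      label ind (below q p) = proj₂ (k q) ind p

{-# OPTIONS --safe #-}
{-# OPTIONS --without-K #-}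

-- Up to a propositional η-rule for labellings, every element of Tμ is of the
-- form into (s , u , k), so recursion on the underlying tree gives Tμ an
-- induction principle with a propositional computation rule.  The recursor
-- into an algebra is an algebra morphism definitionally.  For any other
-- morphism f, induction yields a homotopy rec ∼ f, and its computation rule
-- is exactly the coherence needed to identify the two morphism paths.  No UIP
-- is available, so function extensionality is first normalised to send the
-- constant homotopy to refl.

module Submission where

open import Axiom.Extensionality.Propositional using (Extensionality)
open import Data.Container.Core using (_▷_)
open import Data.Product.Base using (Σ-syntax; _,_; proj₁; proj₂)
open import Data.W using (W; sup)
open import Function.Base using (_∘_)
open import Level using (Level)
open import Relation.Binary.PropositionalEquality.Core using (_≡_; refl; sym; trans; cong; cong-app; subst)
open import Relation.Binary.PropositionalEquality.Properties using (trans-symˡ; trans-reflʳ; trans-assoc)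
open import Defs

private
  variable
    ℓ : Level

module FunExt (ext : Extensionality ℓ ℓ) where

  Homotopic : {A : Set ℓ} {B : A → Set ℓ} (f g : (x : A) → B x) → Set ℓ
  Homotopic f g = ∀ x → f x ≡ g x

  module _ {A : Set ℓ} {B : A → Set ℓ} where

    module _ {f : (x : A) → B x} where

      Homotopies : Set ℓ
      Homotopies = Σ[ g ∈ ((x : A) → B x) ] Homotopic f g

      constant : Homotopies
      constant = f , λ _ → refl

      -- Pointwise, homotopies out of f are elements of the singletons of f x.
      constant-≡ : (H : Homotopies) → constant ≡ H
      constant-≡ (g , h) = cong (λ u → proj₁ ∘ u , proj₂ ∘ u) (ext (λ x → singleton (h x)))
        where
        singleton : ∀ {x y} (e : f x ≡ y) → (f x , refl) ≡ (y , e)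
        singleton refl = refl

      -- Prefixing the inverse of `constant-≡ constant` cancels whatever path `ext` produces at the
      -- constant homotopy.
      contraction : (H : Homotopies) → constant ≡ H
      contraction H = trans (sym (constant-≡ constant)) (constant-≡ H)

      contraction-constant : contraction constant ≡ refl
      contraction-constant = trans-symˡ (constant-≡ constant)

      homotopy-ind : (M : Homotopies → Set ℓ) → M constant → ∀ H → M H
      homotopy-ind M m H = subst M (contraction H) m

      funext : {g : (x : A) → B x} → Homotopic f g → f ≡ g
      funext {g} h = cong proj₁ (contraction (g , h))

      funext-refl : funext (λ _ → refl) ≡ refl
      funext-refl = cong (cong proj₁) contraction-constant

    funext-cong-app : {f g : (x : A) → B x} (e : f ≡ g) → funext (cong-app e) ≡ e
    funext-cong-app refl = funext-refl

    -- `funext` is a left inverse of `cong-app`, so a path is recovered from its pointwise values.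
    cong-app-injective : {f g : (x : A) → B x} (p q : f ≡ g) →
                         Homotopic (cong-app p) (cong-app q) → p ≡ q
    cong-app-injective p q h =
      trans (sym (funext-cong-app p)) (trans (cong funext (ext h)) (funext-cong-app q))

    funext-∼refl : {f : (x : A) → B x} (h : Homotopic f f) →
                   (∀ x → h x ≡ refl) → funext h ≡ refl
    funext-∼refl h h∼refl = trans (cong funext (ext h∼refl)) funext-refl

module Initiality (ext : Extensionality ℓ ℓ) {Ind S : Set ℓ}
  (P : Ind → S → Set ℓ) (Q : S → Set ℓ) (X : Ind → Set ℓ) where

  open FunExt ext
  open WildFunctor (G P Q X)

  T : Set ℓ
  T = Tμ P Q X

  inT : F₀ T → T
  inT = into P Q X

  Labelling : W (S ▷ Q) → Set ℓ
  Labelling w = (ind : Ind) → Pos P Q (WAlg S Q) ind w → X ind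

  module _ {s : S} {f : Q s → W (S ▷ Q)} where

    out : Labelling (sup (s , f)) → F₀ T
    out l = s , (λ ind p → l ind (here p)) , λ q → f q , λ ind p → l ind (below q p)

    relabel-∼ : (l : Labelling (sup (s , f))) → ∀ ind p → proj₂ (inT (out l)) ind p ≡ l ind p
    relabel-∼ l ind (here p)    = refl
    relabel-∼ l ind (below q p) = refl

    relabel : (l : Labelling (sup (s , f))) → proj₂ (inT (out l)) ≡ l
    relabel l = funext (λ ind → funext (relabel-∼ l ind))

    into-out : (l : Labelling (sup (s , f))) → inT (out l) ≡ (sup (s , f) , l)
    into-out l = cong (sup (s , f) ,_) (relabel l)

  -- Here `relabel-∼` is `refl` on both constructors of `Pos`, and the normalised `funext` preserves
  -- this; hence the transport in `elim` vanishes on `inT x`.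
  into-out-into : (x : F₀ T) → into-out (proj₂ (inT x)) ≡ refl
  into-out-into x = cong (cong (_ ,_))
    (funext-∼refl _ (λ ind → funext-∼refl _ (relabel-∼-refl ind)))
    where
    relabel-∼-refl : ∀ ind p → relabel-∼ (proj₂ (inT x)) ind p ≡ refl
    relabel-∼-refl ind (here p)    = refl
    relabel-∼-refl ind (below q p) = refl

  module Induction (M : T → Set ℓ)
    (step : ∀ s u (k : Q s → T) → (∀ q → M (k q)) → M (inT (s , u , k))) where

    elim : ∀ w l → M (w , l)
    elim (sup (s , f)) l = subst M (into-out l)
      (step s _ _ (λ q → elim (f q) (λ ind p → l ind (below q p))))

    ind : ∀ t → M t
    ind (w , l) = elim w l

    ind-into : ∀ s u k → ind (inT (s , u , k)) ≡ step s u k (ind ∘ k)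
    ind-into s u k = cong (λ e → subst M e (step s u k (ind ∘ k))) (into-out-into (s , u , k))

  module _ {Y : Set ℓ} (α : F₀ Y → Y) where

    -- Defined directly rather than by `elim`, to avoid its transport: the morphism square of `rec`
    -- then commutes by `refl`.
    fold : ∀ w → Labelling w → Y
    fold (sup (s , f)) l =
      α (s , (λ ind p → l ind (here p)) , λ q → fold (f q) (λ ind p → l ind (below q p)))

    rec : T → Y
    rec (w , l) = fold w l

    Morphism : Set ℓ
    Morphism = AlgebraMorphism (G P Q X) (T , inT) (Y , α)

    rec-morphism : Morphism
    rec-morphism = rec , refl

    F₁-∼ : {f g : T → Y} → Homotopic f g → ∀ s u (k : Q s → T) →
           α (s , u , f ∘ k) ≡ α (s , u , g ∘ k)
    F₁-∼ h s u k = cong (λ v → α (s , u , v)) (funext (h ∘ k))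

    Coherent : ((f , p) (g , q) : Morphism) → Homotopic f g → Set ℓ
    Coherent (f , p) (g , q) h = ∀ s u k →
      trans (cong-app p (s , u , k)) (F₁-∼ h s u k) ≡
      trans (h (inT (s , u , k))) (cong-app q (s , u , k))

    morphism-≡ : (m n : Morphism) (h : Homotopic (proj₁ m) (proj₁ n)) → Coherent m n h → m ≡ n
    morphism-≡ (f , p) (g , q) h = homotopy-ind
      -- The type of `q` mentions `g`, so `q` is generalised. At the constant homotopy `F₁-∼`
      -- reduces to `refl` along `funext-refl`, and coherence says that `p` and `q` agree pointwise.
      (λ (g , h) → ∀ q → Coherent (f , p) (g , q) h → (f , p) ≡ (g , q))
      (λ q c → cong (f ,_) (cong-app-injective p q (λ (s , u , k) →
        trans (sym (trans-reflʳ _))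
          (trans (cong (trans (cong-app p (s , u , k)))
                   (sym (cong (cong (λ v → α (s , u , v))) funext-refl)))
            (c s u k)))))
      (g , h) q

    rec-unique : (m : Morphism) → rec-morphism ≡ m
    rec-unique (f , p) = morphism-≡ rec-morphism (f , p) ind coherent
      where
      step : ∀ s u (k : Q s → T) → (∀ q → rec (k q) ≡ f (k q)) →
             rec (inT (s , u , k)) ≡ f (inT (s , u , k))
      -- This is the coherence equation solved for the homotopy at `inT (s , u , k)`.
      step s u k ih = trans (cong (λ v → α (s , u , v)) (funext ih)) (sym (cong-app p (s , u , k)))

      open Induction (λ t → rec t ≡ f t) step

      coherent : Coherent rec-morphism (f , p) ind
      coherent s u k = sym
        -- Unfolding `ind` at `inT x` exposes the inverse of `cong-app p x`, which cancels.
        (trans (cong (λ e → trans e (cong-app p x)) (ind-into s u k))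
          (trans (trans-assoc (F₁-∼ ind s u k))
            (trans (cong (trans (F₁-∼ ind s u k)) (trans-symˡ (cong-app p x)))
              (trans-reflʳ _))))
        where
        x : F₀ T
        x = s , u , k

mainTheorem2 : {ℓ : Level} → Extensionality ℓ ℓ →
    (Ind S : Set ℓ) (P : Ind → S → Set ℓ) (Q : S → Set ℓ) (X : Ind → Set ℓ) →
    IsInitial (G P Q X) (Tμ P Q X , into P Q X)
mainTheorem2 ext Ind S P Q X (Y , α) = rec-morphism α , rec-unique α
  where open Initiality ext P Q X
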